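{- Let $G$ be a diamond-free graph. Then $G$ is clique-perfect if and only if $G$ is balanced.
   Context: Graphs are finite and simple. The clique-matrix $A_G$ has columns indexed by $V(G)$ and rows the incidence vectors of the maximal cliques of $G$. A $\{0,1\}$-matrix is balanced if it has no square submatrix of odd order with exactly two 1's per row and per column; $G$ is balanced if $A_G$ is balanced. The diamond is $K_4$ minus an edge; diamond-free means no induced diamond. A clique-transversal of $G$ is a set of vertices meeting every maximal clique of $G$; $\tau_c(G)$ is the minimum size of a clique-transversal. A clique-independent set is a collection of pairwise vertex-disjoint maximal cliques; $\alpha_c(G)$ is its maximum size. $G$ is clique-perfect if $\tau_c(G')=\alpha_c(G')$ for every induced subgraph $G'$ of $G$. -}

module Defs where

open import Data.Nat using (ℕ; zero; suc; _+_; _*_; _≤_)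
open import Data.Bool using (Bool; true; false)
open import Data.Fin using (Fin; zero; suc)
open import Data.Fin.Subset using (Subset; _∈_; _⊆_; ∣_∣)
open import Data.Vec using (tabulate; lookup)
open import Data.Empty using (⊥)
open import Data.Product using (Σ; ∃; _×_; _,_)
open import Relation.Binary.PropositionalEquality using (_≡_; _≢_)
open import Relation.Nullary using (¬_)
open import Function.Definitions using (Injective)

record Graph : Set where
  constructor mkGraph
  field
    n      : ℕ
    adj    : Fin n → Fin n → Bool
    sym    : ∀ u v → adj u v ≡ adj v u
    irrefl : ∀ v → adj v v ≡ false

open Graph public

-- Induced subgraph of G on the image of an injective map f : Fin m → Fin (n G)
-- (every induced subgraph arises this way, up to relabelling of vertices).
induced : (G : Graph) (m : ℕ) (f : Fin m → Fin (n G)) → Graph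
induced G m f = mkGraph m (λ i j → adj G (f i) (f j))
                         (λ i j → sym G (f i) (f j))
                         (λ i → irrefl G (f i))

IsClique : (G : Graph) → Subset (n G) → Set
IsClique G S = (∃ λ v → v ∈ S) ×
               (∀ u v → u ∈ S → v ∈ S → u ≢ v → adj G u v ≡ true)

IsMaximalClique : (G : Graph) → Subset (n G) → Set
IsMaximalClique G S = IsClique G S × (∀ T → IsClique G T → S ⊆ T → T ⊆ S)

-- Maximal cliques of G (the maximality proof is irrelevant, so a maximal
-- clique is identified with its vertex set).
record MaxClique (G : Graph) : Set where
  constructor mkMaxClique
  field
    set     : Subset (n G)
    .isMax  : IsMaximalClique G set

open MaxClique public

Matrix : Set → ℕ → Set
Matrix R c = R → Fin c → Bool

cliqueMatrix : (G : Graph) → Matrix (MaxClique G) (n G)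
cliqueMatrix G Q v = lookup (set Q) v

Odd : ℕ → Set
Odd k = ∃ λ m → k ≡ suc (m * 2)

Balanced : {R : Set} {c : ℕ} → Matrix R c → Set
Balanced {R} {c} M =
  ∀ (k : ℕ) → Odd k →
  ∀ (ρ : Fin k → R) (γ : Fin k → Fin c) →
  Injective _≡_ _≡_ ρ → Injective _≡_ _≡_ γ →
  ¬ ( (∀ i → ∣ tabulate (λ j → M (ρ i) (γ j)) ∣ ≡ 2)
    × (∀ j → ∣ tabulate (λ i → M (ρ i) (γ j)) ∣ ≡ 2) )

BalancedGraph : Graph → Set
BalancedGraph G = Balanced (cliqueMatrix G)

-- The diamond K4 - e on vertices 0,1,2,3, with the non-edge {2,3}.
diamondAdj : Fin 4 → Fin 4 → Bool
diamondAdj zero zero = false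
diamondAdj zero _ = true
diamondAdj (suc zero) (suc zero) = false
diamondAdj (suc zero) _ = true
diamondAdj (suc (suc zero)) zero = true
diamondAdj (suc (suc zero)) (suc zero) = true
diamondAdj (suc (suc zero)) _ = false
diamondAdj (suc (suc (suc zero))) zero = true
diamondAdj (suc (suc (suc zero))) (suc zero) = true
diamondAdj (suc (suc (suc zero))) _ = false

HasInducedDiamond : Graph → Set
HasInducedDiamond G =
  Σ (Fin 4 → Fin (n G)) λ f → Injective _≡_ _≡_ f ×
    (∀ i j → adj G (f i) (f j) ≡ diamondAdj i j)

DiamondFree : Graph → Set
DiamondFree G = ¬ HasInducedDiamond G

IsCliqueTransversal : (G : Graph) → Subset (n G) → Set
IsCliqueTransversal G T =
  ∀ S → IsMaximalClique G S → ∃ λ v → v ∈ T × v ∈ S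

τc≡ : Graph → ℕ → Set
τc≡ G t = (∃ λ T → IsCliqueTransversal G T × ∣ T ∣ ≡ t)
        × (∀ T → IsCliqueTransversal G T → t ≤ ∣ T ∣)

IsCliqueIndependent : (G : Graph) (k : ℕ) → (Fin k → Subset (n G)) → Set
IsCliqueIndependent G k Q =
  (∀ i → IsMaximalClique G (Q i)) ×
  (∀ i j → i ≢ j → ∀ v → v ∈ Q i → v ∈ Q j → ⊥)

αc≡ : Graph → ℕ → Set
αc≡ G a = (∃ λ Q → IsCliqueIndependent G a Q)
        × (∀ k Q → IsCliqueIndependent G k Q → k ≤ a)

CliquePerfect : Graph → Set
CliquePerfect G =
  ∀ (m : ℕ) (f : Fin m → Fin (n G)) → Injective _≡_ _≡_ f →
  ∃ λ t → τc≡ (induced G m f) t × αc≡ (induced G m f) t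

{-# OPTIONS --safe #-}
module Submission where

-- Balanced ⇒ clique-perfect is the König property of balanced hypergraphs, applied to the maximal
-- cliques of an induced subgraph.  Two-colour the edges so that every vertex of degree at least 2
-- sees both colours; recolouring two classes in this way until no vertex sees a colour twice
-- gives a proper edge colouring with as many colours as the maximum degree.  If every
-- vertex w is missed by a matching M_w of size q, the union of these n matchings has n q edges and
-- maximum degree n - 1 (M_w misses w), so one of n - 1 colour classes is a matching of size q + 1.
-- Hence some vertex meets every maximum matching, and deleting it gives the cover by induction.
--
-- Conversely, let k be odd and consider a k × k submatrix with two 1's per row and column.
-- Without diamonds, a vertex adjacent to two vertices of a maximal clique lies in the clique, so
-- the rows restrict to maximal cliques (pairs) of the subgraph H induced by the columns.  Every
-- vertex of H lies in two of these k pairs, hence k ≤ 2 τ(H), while all maximal cliques of H have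
-- at least two vertices, hence 2 α(H) ≤ k; as k is odd, τ(H) ≠ α(H).

open import Defs hiding (sym)
open import Data.Bool using (Bool; true; false; not; if_then_else_)
import Data.Bool.Properties as Bool
open import Data.Empty using (⊥; ⊥-elim)
open import Data.Fin
  using (Fin; zero; suc; toℕ; fromℕ; inject₁; fromℕ<; inject≤; punchOut; remQuot; combine)
open import Data.Fin.Permutation using (_⟨$⟩ʳ_; transpose)
open import Data.Fin.Properties
  using (_≟_; any?; all?; suc-injective; 0≢1+n; toℕ-injective; toℕ<n; toℕ≤pred[n]; toℕ-fromℕ;
         toℕ-fromℕ<; toℕ-inject₁; inject₁-injective; fromℕ≢inject₁; inject≤-injective;
         injective⇒≤; punchOut-injective; combine-remQuot)
open import Data.Fin.Relation.Unary.Top using (view; ‵fromℕ; ‵inject₁)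
open import Data.Fin.Subset
  using (Subset; _∈_; _∉_; _⊆_; ∣_∣; _-_; _∪_; ⁅_⁆; Nonempty; ⊤) renaming (⊥ to ∅)
open import Data.Fin.Subset.Properties
  using (_∈?_; _⊆?_; nonempty?; anySubset?; ∈⊤; p─q⊆p; x∈p∧x≢y⇒x∈p-y; x∈p⇒∣p-x∣<∣p∣;
         ∣⊥∣≡0; ∣⁅x⁆∣≡1; x∈⁅x⁆; x∈⁅y⁆⇒x≡y; p⊆p∪q; q⊆p∪q; x∈p∪q⁻; p⊆q⇒∣p∣≤∣q∣; p⊂q⇒∣p∣<∣q∣; ∣p∣≤n)
open import Data.List using (List; []; _∷_; length; filter; map; _++_)
open import Data.List.Membership.Propositional using () renaming (_∈_ to _∈ₗ_)
open import Data.List.Membership.Propositional.Properties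
  using (∈-filter⁺; ∈-filter⁻; ∈-map⁺; ∈-++⁺ˡ; ∈-++⁺ʳ)
open import Data.List.Properties using (filter-notAll)
open import Data.List.Relation.Unary.Any as Any using (Any)
open import Data.Nat using (ℕ; zero; suc; _+_; _*_; _≤_; _<_; z≤n; s≤s)
open import Data.Nat.Induction using (<-wellFounded)
import Data.Nat.Properties as ℕ
open import Algebra.Properties.CommutativeMonoid.Sum ℕ.+-0-commutativeMonoid
  using (sum; sum-permute; ∑-comm; ∑-distrib-+; sum-cong-≗; sum-replicate-zero)
open import Data.Product using (Σ; ∃; _×_; _,_; proj₁; proj₂; uncurry)
open import Data.Sum as Sum using (_⊎_; inj₁; inj₂)
open import Data.Vec using ([]; _∷_; here; there; tabulate; lookup)
open import Data.Vec.Properties using (lookup⇒[]=; []=⇒lookup; lookup∘tabulate; tabulate∘lookup)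
open import Function using (_∘_)
open import Function.Definitions using (Injective)
open import Induction.WellFounded using (Acc; acc)
open import Relation.Binary.PropositionalEquality
  using (_≡_; _≢_; refl; sym; trans; cong; cong₂; subst; subst₂; module ≡-Reasoning)
open import Relation.Nullary using (¬_; Dec; yes; no; does)
open import Relation.Nullary.Decidable
  using (_×-dec_; _⊎-dec_; _→-dec_; ¬?; map′; recompute; decidable-stable; dec-true; dec-false)
open import Relation.Unary using (Decidable)

-- Deletion from subsets, and odd cycles of sets.

x∉p-x : ∀ {n} (p : Subset n) x → x ∉ p - x
x∉p-x (_ ∷ p) zero ()
x∉p-x (_ ∷ p) (suc x) (there q) = x∉p-x p x q

x∈p-y⇒x≢y : ∀ {n} {p : Subset n} {x y} → x ∈ p - y → x ≢ y
x∈p-y⇒x≢y {p = p} {x} q refl = x∉p-x p x q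

x∈p-y⇒x∈p : ∀ {n} {p : Subset n} {x y} → x ∈ p - y → x ∈ p
x∈p-y⇒x∈p {p = p} = p─q⊆p p _

even⊎odd : ∀ t → (∃ λ h → t ≡ h * 2) ⊎ (∃ λ h → t ≡ suc (h * 2))
even⊎odd zero = inj₁ (0 , refl)
even⊎odd (suc t) with even⊎odd t
... | inj₁ (h , eq) = inj₂ (h , cong suc eq)
... | inj₂ (h , eq) = inj₁ (suc h , cong suc eq)

cyclicPred : ∀ {k} → Fin (suc k) → Fin (suc k)
cyclicPred zero    = fromℕ _
cyclicPred (suc i) = inject₁ i

-- The sets Q form a cycle: ρ a lies in exactly two of them, Q a and its predecessor.
CyclicIncidence : ∀ {n k} → (Fin (suc k) → Fin n) → (Fin (suc k) → Subset n) → Set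
CyclicIncidence ρ Q = ∀ a b → (ρ a ∈ Q b → b ≡ a ⊎ b ≡ cyclicPred a)
                            × (b ≡ a ⊎ b ≡ cyclicPred a → ρ a ∈ Q b)

-- Berge's balancedness: at lengths `3 + h * 2` the incidence pattern makes all vertices and all
-- edges distinct, and no edge contains a third vertex of the cycle.
OddCycleFree : ∀ {n} → (Subset n → Set) → Set
OddCycleFree {n} E = ∀ h (ρ : Fin (3 + h * 2) → Fin n) (Q : Fin (3 + h * 2) → Subset n) →
  (∀ b → E (Q b)) → ¬ CyclicIncidence ρ Q

-- Two-colouring the edges.

module Bicolouring {n m} (e : Fin m → Subset n) where

  -- For distinct `x` and `y` in `U` the witness has degree two in `U`, so every bicolouring of `U`
  -- gives `x` and `y` opposite colours.
  Link : Subset m → Fin m → Fin m → Set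
  Link U x y = ∃ λ v → v ∈ e x × v ∈ e y × (∀ z → z ∈ U → v ∈ e z → z ≡ x ⊎ z ≡ y)

  link? : ∀ U x y → Dec (Link U x y)
  link? U x y = any? λ v → (v ∈? e x) ×-dec (v ∈? e y) ×-dec
    all? λ z → (z ∈? U) →-dec ((v ∈? e z) →-dec ((z ≟ x) ⊎-dec (z ≟ y)))

  -- Only the values p 0, …, p ℓ matter, so that prefixes of a path are again given by p.
  record IsPath (U : Subset m) (ℓ : ℕ) (p : ℕ → Fin m) : Set where
    field
      inside    : ∀ t → t ≤ ℓ → p t ∈ U
      injective : ∀ s t → s ≤ ℓ → t ≤ ℓ → p s ≡ p t → s ≡ t
      linked    : ∀ t → t < ℓ → Link U (p t) (p (suc t))
  open IsPath

  prefix : ∀ {U ℓ i p} → i ≤ ℓ → IsPath U ℓ p → IsPath U i p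
  prefix i≤ℓ P = record
    { inside    = λ t q → inside P t (ℕ.≤-trans q i≤ℓ)
    ; injective = λ s t q r → injective P s t (ℕ.≤-trans q i≤ℓ) (ℕ.≤-trans r i≤ℓ)
    ; linked    = λ t q → linked P t (ℕ.<-≤-trans q i≤ℓ)
    }

  length<m : ∀ {U ℓ p} → IsPath U ℓ p → ℓ < m
  length<m {p = p} P = injective⇒≤ {f = p ∘ toℕ} λ {s} {t} eq →
    toℕ-injective (injective P _ _ (toℕ≤pred[n] s) (toℕ≤pred[n] t) eq)

  -- The witness of a link lies in no further edge of `U`, so on the path it lies in the two linked
  -- edges only. The closing link supplies vertex `zero`, whose predecessor position is the last
  -- one.
  closedPath⇒cycle : ∀ {U ℓ p} → IsPath U ℓ p → Link U (p ℓ) (p 0) →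
    Σ (Fin (suc ℓ) → Fin n) λ ρ → CyclicIncidence ρ (e ∘ p ∘ toℕ)
  closedPath⇒cycle {U} {ℓ} {p} P (v , v∈ℓ , v∈0 , only) = ρ , incident
    where
    ρ : Fin (suc ℓ) → Fin n
    ρ zero    = v
    ρ (suc i) = proj₁ (linked P (toℕ i) (toℕ<n i))

    position : ∀ {t} (b : Fin (suc ℓ)) → t ≤ ℓ → p (toℕ b) ≡ p t → toℕ b ≡ t
    position b = injective P _ _ (toℕ≤pred[n] b)

    incident : CyclicIncidence ρ (e ∘ p ∘ toℕ)
    incident zero b = to , from
      where
      to : v ∈ e (p (toℕ b)) → _
      to q with only _ (inside P _ (toℕ≤pred[n] b)) q
      ... | inj₁ eq = inj₂ (toℕ-injective (trans (position b ℕ.≤-refl eq) (sym (toℕ-fromℕ ℓ))))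
      ... | inj₂ eq = inj₁ (toℕ-injective (position b z≤n eq))
      from : _ → v ∈ e (p (toℕ b))
      from (inj₁ refl) = v∈0
      from (inj₂ refl) = subst (λ t → v ∈ e (p t)) (sym (toℕ-fromℕ ℓ)) v∈ℓ
    incident (suc i) b with linked P (toℕ i) (toℕ<n i)
    ... | w , w∈i , w∈si , onlyᵢ = to , from
      where
      to : w ∈ e (p (toℕ b)) → _
      to q with onlyᵢ _ (inside P _ (toℕ≤pred[n] b)) q
      ... | inj₁ eq = inj₂ (toℕ-injective
              (trans (position b (ℕ.<⇒≤ (toℕ<n i)) eq) (sym (toℕ-inject₁ i))))
      ... | inj₂ eq = inj₁ (toℕ-injective (position b (toℕ<n i) eq))
      from : _ → w ∈ e (p (toℕ b))
      from (inj₁ refl) = w∈si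
      from (inj₂ refl) = subst (λ t → w ∈ e (p t)) (sym (toℕ-inject₁ i)) w∈i

  -- Maximality concerns the head only: the head is the edge that the induction deletes, and its
  -- links must be controlled.
  record MaximalPath (U : Subset m) : Set where
    field
      {ℓ}     : ℕ
      {p}     : ℕ → Fin m
      isPath  : IsPath U ℓ p
      maximal : ∀ y → y ∈ U → Link U y (p 0) → ∃ λ t → t ≤ ℓ × p t ≡ y

  maximalPath : ∀ {U x} → x ∈ U → MaximalPath U
  maximalPath {U} {x} x∈U = extend m (ℕ.m≤n+m m 0) single
    where
    single : IsPath U 0 (λ _ → x)
    single = record
      { inside    = λ _ _ → x∈U
      ; injective = λ { _ _ z≤n z≤n _ → refl }
      ; linked    = λ _ ()
      }

    -- New edges go in front of the path. Distinctness forces `ℓ < m`, so the fuel cannot run out.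
    extend : ∀ {ℓ p} fuel → m ≤ ℓ + fuel → IsPath U ℓ p → MaximalPath U
    extend {ℓ} zero m≤ P =
      ⊥-elim (ℕ.<⇒≱ (length<m P) (ℕ.≤-trans m≤ (ℕ.≤-reflexive (ℕ.+-identityʳ ℓ))))
    extend {ℓ} {p} (suc fuel) m≤ P
      with any? (λ y → (y ∈? U) ×-dec link? U y (p 0) ×-dec
                       ¬? (any? {suc ℓ} (λ t → p (toℕ t) ≟ y)))
    ... | no ¬y = record { isPath = P ; maximal = on-path }
      where
      on-path : ∀ y → y ∈ U → Link U y (p 0) → ∃ λ t → t ≤ ℓ × p t ≡ y
      on-path y y∈U link with any? {suc ℓ} (λ t → p (toℕ t) ≟ y)
      ... | yes (t , eq) = toℕ t , toℕ≤pred[n] t , eq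
      ... | no ¬t        = ⊥-elim (¬y (y , y∈U , link , ¬t))
    ... | yes (y , y∈U , link , fresh) =
          extend fuel (ℕ.≤-trans m≤ (ℕ.≤-reflexive (ℕ.+-suc ℓ fuel))) P′
      where
      p′ : ℕ → Fin m
      p′ zero    = y
      p′ (suc t) = p t

      fresh′ : ∀ t → t ≤ ℓ → p t ≢ y
      fresh′ t t≤ℓ eq = fresh (fromℕ< (s≤s t≤ℓ) , trans (cong p (toℕ-fromℕ< (s≤s t≤ℓ))) eq)

      P′ : IsPath U (suc ℓ) p′
      P′ .inside zero    _       = y∈U
      P′ .inside (suc t) (s≤s q) = inside P t q
      P′ .injective zero    zero    _       _       _  = refl
      P′ .injective zero    (suc t) _       (s≤s r) eq = ⊥-elim (fresh′ t r (sym eq))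
      P′ .injective (suc s) zero    (s≤s q) _       eq = ⊥-elim (fresh′ s q eq)
      P′ .injective (suc s) (suc t) (s≤s q) (s≤s r) eq = cong suc (injective P s t q r eq)
      P′ .linked zero    _       = link
      P′ .linked (suc t) (s≤s q) = linked P t q

  -- A two-colouring of the dual hypergraph on `U` in which no vertex of degree at least two is
  -- monochromatic.
  Bicoloured : Subset m → (Fin m → Bool) → Set
  Bicoloured U d = ∀ {v x y} → x ∈ U → y ∈ U → x ≢ y → v ∈ e x → v ∈ e y →
    ∀ b → ∃ λ z → z ∈ U × v ∈ e z × d z ≡ b

  module _ (acyclic : ∀ h (γ : Fin (3 + h * 2) → Fin m) ρ → ¬ CyclicIncidence ρ (e ∘ γ)) where

    -- Remove the head j of a maximal path p and colour U - j.  Colours alternate along the rest of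
    -- p, and every neighbour of j is some p t.  An even t would close an odd cycle, so all
    -- neighbours have the colour of p 1 and j can take the other colour (if j is isolated, p 1
    -- is an arbitrary value and the choice is harmless).
    bicolouring : ∀ U → ∃ (Bicoloured U)
    bicolouring U = go U (<-wellFounded ∣ U ∣)
      where
      go : ∀ U → Acc _<_ ∣ U ∣ → ∃ (Bicoloured U)
      go U (acc rec) with nonempty? U
      ... | no empty = (λ _ → true) , λ x∈U → ⊥-elim (empty (_ , x∈U))
      ... | yes (_ , x∈U) = d′ , bicoloured′
        where
        open MaximalPath (maximalPath x∈U)

        j = p 0

        j∈U : j ∈ U
        j∈U = inside isPath 0 z≤n

        IH : ∃ (Bicoloured (U - j))
        IH = go (U - j) (rec (x∈p⇒∣p-x∣<∣p∣ j∈U))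

        d = proj₁ IH

        d′ : Fin m → Bool
        d′ z = if does (z ≟ j) then not (d (p 1)) else d z

        d′-head : d′ j ≡ not (d (p 1))
        d′-head with j ≟ j
        ... | yes _  = refl
        ... | no j≢j = ⊥-elim (j≢j refl)

        d′-other : ∀ {z} → z ≢ j → d′ z ≡ d z
        d′-other {z} z≢j with z ≟ j
        ... | yes eq = ⊥-elim (z≢j eq)
        ... | no _   = refl

        tail∈ : ∀ t → suc t ≤ ℓ → p (suc t) ∈ U - j
        tail∈ t q = x∈p∧x≢y⇒x∈p-y (inside isPath _ q)
          λ eq → ℕ.1+n≢0 (injective isPath _ 0 q z≤n eq)

        -- The linking vertex sees both colours by induction, but only these two edges of `U`.
        alternates : ∀ t → 2 + t ≤ ℓ → d (p (2 + t)) ≡ not (d (p (1 + t)))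
        alternates t q with linked isPath (suc t) q
        ... | v , v∈x , v∈y , only
          with proj₂ IH (tail∈ t (ℕ.<⇒≤ q)) (tail∈ (suc t) q)
                 (λ eq → ℕ.1+n≢n (sym (injective isPath _ _ (ℕ.<⇒≤ q) q eq)))
                 v∈x v∈y (not (d (p (suc t))))
        ... | z , z∈ , v∈z , dz with only z (x∈p-y⇒x∈p z∈) v∈z
        ... | inj₁ refl = ⊥-elim (Bool.not-¬ refl dz)
        ... | inj₂ refl = dz

        odd-colour : ∀ h → suc (h * 2) ≤ ℓ → d (p (suc (h * 2))) ≡ d (p 1)
        odd-colour zero    q = refl
        odd-colour (suc h) q = begin
          d (p (3 + h * 2))             ≡⟨ alternates _ q ⟩
          not (d (p (2 + h * 2)))       ≡⟨ cong not (alternates _ (ℕ.<⇒≤ q)) ⟩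
          not (not (d (p (1 + h * 2)))) ≡⟨ Bool.not-involutive _ ⟩
          d (p (1 + h * 2))             ≡⟨ odd-colour h (ℕ.<⇒≤ (ℕ.<⇒≤ q)) ⟩
          d (p 1)                       ∎
          where open ≡-Reasoning

        neighbour-colour : ∀ {y} → y ∈ U → y ≢ j → Link U y j → d y ≡ d (p 1)
        neighbour-colour y∈U y≢j link with maximal _ y∈U link
        ... | zero  , _   , refl = ⊥-elim (y≢j refl)
        ... | suc t , t≤ℓ , refl with even⊎odd t
        ...   | inj₁ (h , refl) = odd-colour h t≤ℓ
        -- Here `suc t` is `2 + h * 2`, so the prefix ending there has `3 + h * 2` edges and `link`
        -- closes it.
        ...   | inj₂ (h , refl) =
                let ρ , cyclic = closedPath⇒cycle (prefix t≤ℓ isPath) link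
                in ⊥-elim (acyclic h _ ρ cyclic)

        Two : Fin n → Set
        Two v = ∃ λ x → ∃ λ y → x ∈ U - j × y ∈ U - j × x ≢ y × v ∈ e x × v ∈ e y

        two? : ∀ v → Dec (Two v)
        two? v = any? λ x → any? λ y → (x ∈? (U - j)) ×-dec (y ∈? (U - j)) ×-dec
          ¬? (x ≟ y) ×-dec (v ∈? e x) ×-dec (v ∈? e y)

        -- Without two edges of `U - j` at `v`, the only edges of `U` at `v` are `y` and `j`. Hence
        -- `y` is linked to `j`, and the two have opposite colours.
        at-head : ∀ {v y} → ¬ Two v → y ∈ U → y ≢ j → v ∈ e j → v ∈ e y →
          ∀ b → ∃ λ z → z ∈ U × v ∈ e z × d′ z ≡ b
        at-head {v} {y} ¬two y∈U y≢j v∈j v∈y b with b Bool.≟ d (p 1)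
        ... | no b≢ = j , j∈U , v∈j , trans d′-head (sym (Bool.¬-not b≢))
        ... | yes refl = y , y∈U , v∈y ,
                trans (d′-other y≢j) (neighbour-colour y∈U y≢j (v , v∈y , v∈j , only))
          where
          only : ∀ z → z ∈ U → v ∈ e z → z ≡ y ⊎ z ≡ j
          only z z∈U v∈z with z ≟ y | z ≟ j
          ... | yes eq | _      = inj₁ eq
          ... | _      | yes eq = inj₂ eq
          ... | no z≢y | no z≢j = ⊥-elim (¬two (z , y ,
                  x∈p∧x≢y⇒x∈p-y z∈U z≢j , x∈p∧x≢y⇒x∈p-y y∈U y≢j , z≢y , v∈z , v∈y))

        bicoloured′ : Bicoloured U d′
        bicoloured′ {v} {x} {y} x∈U y∈U x≢y v∈x v∈y b with two? v
        ... | yes (_ , _ , x∈ , y∈ , x≢y , v∈x , v∈y) =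
              let z , z∈ , v∈z , eq = proj₂ IH x∈ y∈ x≢y v∈x v∈y b
              in z , x∈p-y⇒x∈p z∈ , v∈z , trans (d′-other (x∈p-y⇒x≢y {p = U} z∈)) eq
        ... | no ¬two with x ≟ j | y ≟ j
        ...   | yes refl | _        = at-head ¬two y∈U (x≢y ∘ sym) v∈x v∈y b
        ...   | no x≢j   | yes refl = at-head ¬two x∈U x≢j v∈y v∈x b
        ...   | no x≢j   | no y≢j   = ⊥-elim (¬two (x , y ,
                x∈p∧x≢y⇒x∈p-y x∈U x≢j , x∈p∧x≢y⇒x∈p-y y∈U y≢j , x≢y , v∈x , v∈y))

-- Finite sums and counting.

comprehension : ∀ {n} {P : Fin n → Set} → Decidable P → Subset n
comprehension P? = tabulate (does ∘ P?)

module _ {n} {P : Fin n → Set} (P? : Decidable P) where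

  ∈-comprehension⁺ : ∀ {x} → P x → x ∈ comprehension P?
  ∈-comprehension⁺ {x} px =
    lookup⇒[]= x _ (trans (lookup∘tabulate _ x) (dec-true (P? x) px))

  ∈-comprehension⁻ : ∀ {x} → x ∈ comprehension P? → P x
  ∈-comprehension⁻ {x} x∈ with P? x | trans (sym (lookup∘tabulate (does ∘ P?) x)) ([]=⇒lookup x∈)
  ... | yes px | _ = px

sum-mono-≤ : ∀ {n} {f g : Fin n → ℕ} → (∀ i → f i ≤ g i) → sum f ≤ sum g
sum-mono-≤ {zero}  f≤g = z≤n
sum-mono-≤ {suc n} f≤g = ℕ.+-mono-≤ (f≤g zero) (sum-mono-≤ (f≤g ∘ suc))

sum-mono-< : ∀ {n} {f g : Fin n → ℕ} → (∀ i → f i ≤ g i) → ∀ i → f i < g i → sum f < sum g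
sum-mono-< f≤g zero    f<g = ℕ.+-mono-<-≤ f<g (sum-mono-≤ (f≤g ∘ suc))
sum-mono-< f≤g (suc i) f<g = ℕ.+-mono-≤-< (f≤g zero) (sum-mono-< (f≤g ∘ suc) i f<g)

sum-const : ∀ n c → sum {n} (λ _ → c) ≡ n * c
sum-const zero    c = refl
sum-const (suc n) c = cong (c +_) (sum-const n c)

sum-upper : ∀ {n} {f : Fin n → ℕ} {c} → (∀ i → f i ≤ c) → sum f ≤ n * c
sum-upper {n} f≤c = ℕ.≤-trans (sum-mono-≤ f≤c) (ℕ.≤-reflexive (sum-const n _))

indicator : Bool → ℕ
indicator b = if b then 1 else 0

indicator≤1 : ∀ b → indicator b ≤ 1
indicator≤1 false = z≤n
indicator≤1 true  = s≤s z≤n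

indicator-mono : ∀ {P Q : Set} (P? : Dec P) (Q? : Dec Q) → (P → Q) →
  indicator (does P?) ≤ indicator (does Q?)
indicator-mono (no _)  _       _ = z≤n
indicator-mono (yes _) (yes _) _ = ℕ.≤-refl
indicator-mono (yes p) (no ¬q) f = ⊥-elim (¬q (f p))

∣tabulate∣≡sum : ∀ {n} (f : Fin n → Bool) → ∣ tabulate f ∣ ≡ sum (indicator ∘ f)
∣tabulate∣≡sum {zero}  f = refl
∣tabulate∣≡sum {suc n} f with f zero
... | true  = cong suc (∣tabulate∣≡sum (f ∘ suc))
... | false = ∣tabulate∣≡sum (f ∘ suc)

injection⇒≤∣∣ : ∀ {q n} {g : Fin q → Fin n} {p : Subset n} →
  Injective _≡_ _≡_ g → (∀ i → g i ∈ p) → q ≤ ∣ p ∣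
injection⇒≤∣∣ {zero}  g-inj g∈ = z≤n
injection⇒≤∣∣ {suc q} g-inj g∈ = ℕ.≤-<-trans
  (injection⇒≤∣∣ (suc-injective ∘ g-inj)
    λ i → x∈p∧x≢y⇒x∈p-y (g∈ (suc i)) λ eq → case-suc (g-inj eq))
  (x∈p⇒∣p-x∣<∣p∣ (g∈ zero))
  where
  case-suc : ∀ {n} {i : Fin n} → suc i ≢ zero
  case-suc ()

enumerate : ∀ {n} (p : Subset n) {q} → q ≤ ∣ p ∣ →
  Σ (Fin q → Fin n) λ g → Injective _≡_ _≡_ g × (∀ i → g i ∈ p)
enumerate _ {zero} _ = (λ ()) , (λ {}) , λ ()
enumerate (false ∷ p) {suc q} le =
  let g , g-inj , g∈ = enumerate p le
  in suc ∘ g , g-inj ∘ suc-injective , there ∘ g∈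
enumerate (true ∷ p) {suc q} (s≤s le) with enumerate p le
... | g , g-inj , g∈ = g′ , g′-inj , g′∈
  where
  g′ : Fin (suc _) → Fin _
  g′ zero    = zero
  g′ (suc i) = suc (g i)
  g′-inj : Injective _≡_ _≡_ g′
  g′-inj {zero}  {zero}  _  = refl
  g′-inj {zero}  {suc j} ()
  g′-inj {suc i} {zero}  ()
  g′-inj {suc i} {suc j} eq = cong suc (g-inj (suc-injective eq))
  g′∈ : ∀ i → g′ i ∈ true ∷ p
  g′∈ zero    = here
  g′∈ (suc i) = there (g∈ i)

sum-indicator-≡ : ∀ {k} (a : Fin k) → sum (λ b → indicator (does (a ≟ b))) ≡ 1
sum-indicator-≡ {suc k} zero    = cong suc (sum-replicate-zero k)
sum-indicator-≡ {suc k} (suc a) = sum-indicator-≡ a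

-- Double counting: each `x` has exactly one colour, so the class sizes add up to `m`.
largeColourClass : ∀ {m k q} (c : Fin m → Fin k) → k * q < m →
  ∃ λ b → q < ∣ comprehension (λ x → c x ≟ b) ∣
largeColourClass {m} {k} {q} c kq<m
  with any? (λ b → q ℕ.<? ∣ comprehension (λ x → c x ≟ b) ∣)
... | yes large = large
... | no ¬large = ⊥-elim (ℕ.<⇒≱ kq<m (begin
    m                                                ≡⟨ ℕ.*-identityʳ m ⟨
    m * 1                                            ≡⟨ sum-const m 1 ⟨
    sum {m} (λ x → 1)                                ≡⟨ sum-cong-≗ (sum-indicator-≡ ∘ c) ⟨
    sum (λ x → sum λ b → indicator (does (c x ≟ b))) ≡⟨ ∑-comm {m} {k} _ ⟩
    sum (λ b → sum λ x → indicator (does (c x ≟ b))) ≤⟨ sum-upper small ⟩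
    k * q                                            ∎))
  where
  open ℕ.≤-Reasoning
  small : ∀ b → sum (λ x → indicator (does (c x ≟ b))) ≤ q
  small b = subst (_≤ q) (∣tabulate∣≡sum (λ x → does (c x ≟ b))) (ℕ.≮⇒≥ λ lt → ¬large (b , lt))

-- Proper edge colouring with as many colours as the degree bound.

module EdgeColouring {n m} (e : Fin m → Subset n)
  (acyclic : ∀ h (γ : Fin (3 + h * 2) → Fin m) ρ → ¬ CyclicIncidence ρ (e ∘ γ))
  {k} (degree≤k : ∀ v (g : Fin (suc k) → Fin m) → Injective _≡_ _≡_ g → ¬ (∀ i → v ∈ e (g i)))
  where

  open Bicolouring e

  Present : (Fin m → Fin k) → Fin n → Fin k → Set
  Present c v z = ∃ λ x → v ∈ e x × c x ≡ z

  present? : ∀ c v z → Dec (Present c v z)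
  present? c v z = any? λ x → (v ∈? e x) ×-dec (c x ≟ z)

  colours : (Fin m → Fin k) → Fin n → ℕ
  colours c v = sum λ z → indicator (does (present? c v z))

  Conflict : (Fin m → Fin k) → Set
  Conflict c = ∃ λ v → ∃ λ x → ∃ λ y → x ≢ y × v ∈ e x × v ∈ e y × c x ≡ c y

  conflict? : ∀ c → Dec (Conflict c)
  conflict? c = any? λ v → any? λ x → any? λ y →
    ¬? (x ≟ y) ×-dec (v ∈? e x) ×-dec (v ∈? e y) ×-dec (c x ≟ c y)

  -- Otherwise one edge of each colour and the repeated edge are k + 1 edges at v.
  conflict⇒missing : ∀ c ((v , _) : Conflict c) → ∃ λ b → ¬ Present c v b
  conflict⇒missing c (v , x , y , x≢y , v∈x , v∈y , cx≡cy)
    with any? (λ b → ¬? (present? c v b))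
  ... | yes missing = missing
  ... | no none = ⊥-elim (degree≤k v g g-inj g∈)
    where
    all-present : ∀ b → Present c v b
    all-present b with present? c v b
    ... | yes pr = pr
    ... | no ¬pr = ⊥-elim (none (b , ¬pr))

    -- The chosen representative of the common colour of `x` and `y` equals at most one of them; the
    -- other is the additional edge.
    other : ∃ λ w → v ∈ e w × w ≢ proj₁ (all-present (c w))
    other with x ≟ proj₁ (all-present (c x))
    ... | no x≢ = x , v∈x , x≢
    ... | yes x≡ = y , v∈y , λ y≡ →
          x≢y (trans x≡ (trans (cong (proj₁ ∘ all-present) cx≡cy) (sym y≡)))

    g : Fin (suc k) → Fin m
    g zero    = proj₁ other
    g (suc b) = proj₁ (all-present b)

    g-colour : ∀ b → c (g (suc b)) ≡ b
    g-colour b = proj₂ (proj₂ (all-present b))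

    zero≢suc : ∀ b → g zero ≢ g (suc b)
    zero≢suc b eq = proj₂ (proj₂ other)
      (trans eq (cong (proj₁ ∘ all-present) (sym (trans (cong c eq) (g-colour b)))))

    g-inj : Injective _≡_ _≡_ g
    g-inj {zero}  {zero}  _  = refl
    g-inj {zero}  {suc b} eq = ⊥-elim (zero≢suc b eq)
    g-inj {suc a} {zero}  eq = ⊥-elim (zero≢suc a (sym eq))
    g-inj {suc a} {suc b} eq =
      cong suc (trans (sym (g-colour a)) (trans (cong c eq) (g-colour b)))

    g∈ : ∀ i → v ∈ e (g i)
    g∈ zero    = proj₁ (proj₂ other)
    g∈ (suc b) = proj₁ (proj₂ (all-present b))

  module Recolouring (c : Fin m → Fin k) {a b : Fin k} (a≢b : a ≢ b) where

    ab? : Decidable λ x → c x ≡ a ⊎ c x ≡ b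
    ab? x = (c x ≟ a) ⊎-dec (c x ≟ b)

    U = comprehension ab?

    d : Fin m → Bool
    d = proj₁ (bicolouring acyclic U)

    -- A vertex that sees exactly one of a and b may see the other one instead afterwards, hence
    -- the transposition when colours are counted.
    c′ : Fin m → Fin k
    c′ x = if does (ab? x) then (if d x then a else b) else c x

    c′-U : ∀ {x} → c x ≡ a ⊎ c x ≡ b → c′ x ≡ (if d x then a else b)
    c′-U {x} q rewrite dec-true (ab? x) q = refl

    c′-other : ∀ {x} → c x ≢ a → c x ≢ b → c′ x ≡ c x
    c′-other {x} ≢a ≢b rewrite dec-false (ab? x) Sum.[ ≢a , ≢b ] = refl

    c′-ab : ∀ {x} → c x ≡ a ⊎ c x ≡ b → c′ x ≡ a ⊎ c′ x ≡ b
    c′-ab {x} q with d x | c′-U q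
    ... | true  | eq = inj₁ eq
    ... | false | eq = inj₂ eq

    -- Two edges of `U` meet at `v`, so the bicolouring shows `v` both new classes.
    both-present : ∀ {v x y} → x ≢ y → v ∈ e x → v ∈ e y →
      c x ≡ a ⊎ c x ≡ b → c y ≡ a ⊎ c y ≡ b → Present c′ v a × Present c′ v b
    both-present x≢y v∈x v∈y cx cy = class true , class false
      where
      class : ∀ t → Present c′ _ (if t then a else b)
      class t with proj₂ (bicolouring acyclic U) (∈-comprehension⁺ ab? cx)
                     (∈-comprehension⁺ ab? cy) x≢y v∈x v∈y t
      ... | z , z∈ , v∈z , eq = z , v∈z ,
              trans (c′-U (∈-comprehension⁻ ab? z∈)) (cong (λ s → if s then a else b) eq)

    module _ {v : Fin n} where

      other-present : ∀ {z} → z ≢ a → z ≢ b → Present c v z → Present c′ v z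
      other-present ≢a ≢b (x , v∈x , refl) = x , v∈x , c′-other ≢a ≢b

      id-mono : (Present c v a → Present c′ v a) → (Present c v b → Present c′ v b) →
        ∀ z → Present c v z → Present c′ v z
      id-mono fa fb z with z ≟ a | z ≟ b
      ... | yes refl | _        = fa
      ... | no _     | yes refl = fb
      ... | no ≢a    | no ≢b    = other-present ≢a ≢b

      swap-mono : (Present c v a → Present c′ v b) → (Present c v b → Present c′ v a) →
        ∀ z → Present c v z → Present c′ v (transpose a b ⟨$⟩ʳ z)
      swap-mono fa fb z with z ≟ a
      ... | yes refl = fa
      ... | no ≢a with z ≟ b
      ...   | yes refl = fb
      ...   | no ≢b    = other-present ≢a ≢b

      id-≤ : (∀ z → Present c v z → Present c′ v z) → colours c v ≤ colours c′ v
      id-≤ f = sum-mono-≤ λ z → indicator-mono (present? c v z) (present? c′ v z) (f z)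

      swap-≤ : (∀ z → Present c v z → Present c′ v (transpose a b ⟨$⟩ʳ z)) →
        colours c v ≤ colours c′ v
      swap-≤ f = ℕ.≤-trans
        (sum-mono-≤ λ z → indicator-mono (present? c v z) (present? c′ v _) (f z))
        (ℕ.≤-reflexive (sym (sum-permute (λ z → indicator (does (present? c′ v z))) (transpose a b))))

    -- A vertex that saw both `a` and `b` lies in two edges of `U` and still sees both. One that saw
    -- neither keeps its colours. If it saw exactly one, an edge of that colour now has colour `a`
    -- or `b`, and a change is absorbed by the transposition.
    colours-≤ : ∀ v → colours c v ≤ colours c′ v
    colours-≤ v with present? c v a | present? c v b
    ... | yes (x , v∈x , cx) | yes (y , v∈y , cy) =
          let pa , pb = both-present (λ x≡y → a≢b (trans (sym cx) (trans (cong c x≡y) cy)))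
                          v∈x v∈y (inj₁ cx) (inj₂ cy)
          in id-≤ (id-mono (λ _ → pa) (λ _ → pb))
    ... | no ¬a | no ¬b = id-≤ (id-mono (⊥-elim ∘ ¬a) (⊥-elim ∘ ¬b))
    ... | yes (x , v∈x , cx) | no ¬b with c′-ab (inj₁ cx)
    ...   | inj₁ eq = id-≤ (id-mono (λ _ → x , v∈x , eq) (⊥-elim ∘ ¬b))
    ...   | inj₂ eq = swap-≤ (swap-mono (λ _ → x , v∈x , eq) (⊥-elim ∘ ¬b))
    colours-≤ v | no ¬a | yes (x , v∈x , cx) with c′-ab (inj₂ cx)
    ...   | inj₁ eq = swap-≤ (swap-mono (⊥-elim ∘ ¬a) (λ _ → x , v∈x , eq))
    ...   | inj₂ eq = id-≤ (id-mono (⊥-elim ∘ ¬a) (λ _ → x , v∈x , eq))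

    -- Both edges lie in `U`, so `v` keeps `a` and gains `b`.
    colours-< : ∀ {v x y} → x ≢ y → v ∈ e x → v ∈ e y → c x ≡ a → c y ≡ a →
      ¬ Present c v b → colours c v < colours c′ v
    colours-< {v} x≢y v∈x v∈y cx cy ¬pb
      with both-present x≢y v∈x v∈y (inj₁ cx) (inj₁ cy)
    ... | pa , pb = sum-mono-<
          (λ z → indicator-mono (present? c v z) (present? c′ v z)
            (id-mono (λ _ → pa) (λ _ → pb) z))
          b
          (subst₂ (λ s t → indicator s < indicator t)
            (sym (dec-false (present? c v b) ¬pb))
            (sym (dec-true (present? c′ v b) pb)) ℕ.≤-refl)

  totalColours : (Fin m → Fin k) → ℕ
  totalColours c = sum (colours c)

  totalColours≤ : ∀ c → totalColours c ≤ n * k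
  totalColours≤ c = sum-upper λ v → ℕ.≤-trans
    (sum-upper λ z → indicator≤1 (does (present? c v z))) (ℕ.≤-reflexive (ℕ.*-identityʳ k))

  -- The potential `totalColours` is at most `n * k`. It rises whenever a repeated colour at a
  -- vertex is recoloured together with a colour missing there.
  edgeColouring : (Fin m → Fin k) → ∃ (¬_ ∘ Conflict)
  edgeColouring c = go (suc (n * k)) c (ℕ.m≤n+m (suc (n * k)) (totalColours c))
    where
    go : ∀ fuel c → suc (n * k) ≤ totalColours c + fuel → ∃ (¬_ ∘ Conflict)
    go zero c le = ⊥-elim (ℕ.<⇒≱ le
      (ℕ.≤-trans (ℕ.≤-reflexive (ℕ.+-identityʳ _)) (totalColours≤ c)))
    go (suc fuel) c le with conflict? c
    ... | no ¬conflict = c , ¬conflict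
    ... | yes conflict@(v , x , y , x≢y , v∈x , v∈y , cx≡cy)
      with conflict⇒missing c conflict
    ...   | b , ¬pb = go fuel c′ (begin
            suc (n * k)                 ≤⟨ le ⟩
            totalColours c + suc fuel   ≡⟨ ℕ.+-suc _ fuel ⟩
            suc (totalColours c) + fuel ≤⟨ ℕ.+-monoˡ-≤ fuel more ⟩
            totalColours c′ + fuel      ∎)
      where
      open ℕ.≤-Reasoning
      open Recolouring c {c x} {b} (λ cx≡b → ¬pb (x , v∈x , cx≡b))
      more : totalColours c < totalColours c′
      more = sum-mono-< colours-≤ v (colours-< x≢y v∈x v∈y refl (sym cx≡cy) ¬pb)

-- Matchings, transversals and the König property.

∣p∪q∣≤∣p∣+∣q∣ : ∀ {n} (p q : Subset n) → ∣ p ∪ q ∣ ≤ ∣ p ∣ + ∣ q ∣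
∣p∪q∣≤∣p∣+∣q∣ [] [] = z≤n
∣p∪q∣≤∣p∣+∣q∣ (false ∷ p) (false ∷ q) = ∣p∪q∣≤∣p∣+∣q∣ p q
∣p∪q∣≤∣p∣+∣q∣ (false ∷ p) (true  ∷ q) =
  ℕ.≤-trans (s≤s (∣p∪q∣≤∣p∣+∣q∣ p q)) (ℕ.≤-reflexive (sym (ℕ.+-suc ∣ p ∣ ∣ q ∣)))
∣p∪q∣≤∣p∣+∣q∣ (true  ∷ p) (false ∷ q) = s≤s (∣p∪q∣≤∣p∣+∣q∣ p q)
∣p∪q∣≤∣p∣+∣q∣ (true  ∷ p) (true  ∷ q) = s≤s (ℕ.≤-trans (∣p∪q∣≤∣p∣+∣q∣ p q)
  (ℕ.+-monoʳ-≤ ∣ p ∣ (ℕ.n≤1+n ∣ q ∣)))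

-- Finite choice; it combines the verdicts for the single vertices in the König induction.
any⊎all : ∀ {n} {A : Set} {B : Fin n → Set} → (∀ i → A ⊎ B i) → A ⊎ (∀ i → B i)
any⊎all {zero}  f = inj₂ λ ()
any⊎all {suc n} f with f zero | any⊎all (f ∘ suc)
... | inj₁ a | _      = inj₁ a
... | inj₂ _ | inj₁ a = inj₁ a
... | inj₂ b | inj₂ g = inj₂ λ { zero → b ; (suc i) → g i }

Disjoint : ∀ {n q} → (Fin q → Subset n) → Set
Disjoint M = ∀ i j → i ≢ j → ∀ v → v ∈ M i → v ∈ M j → ⊥

-- Weak duality: vertices chosen from disjoint sets are distinct.
disjoint⇒≤∣transversal∣ : ∀ {n q} {M : Fin q → Subset n} {T} → Disjoint M →
  (∀ i → ∃ λ v → v ∈ T × v ∈ M i) → q ≤ ∣ T ∣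
disjoint⇒≤∣transversal∣ {M = M} disjoint hit = injection⇒≤∣∣ injective (proj₁ ∘ proj₂ ∘ hit)
  where
  injective : Injective _≡_ _≡_ (proj₁ ∘ hit)
  injective {i} {j} eq with i ≟ j
  ... | yes i≡j = i≡j
  ... | no i≢j = ⊥-elim (disjoint i j i≢j _ (proj₂ (proj₂ (hit i)))
          (subst (_∈ M j) (sym eq) (proj₂ (proj₂ (hit j)))))

Matching : ∀ {n} → (Subset n → Set) → ℕ → Set
Matching {n} E q = Σ (Fin q → Subset n) λ M → (∀ i → E (M i)) × Disjoint M

matching-size≤n : ∀ {n q} {E : Subset n → Set} → (∀ {Q} → E Q → Nonempty Q) →
  Matching E q → q ≤ n
matching-size≤n nonempty (M , M∈E , disjoint) = ℕ.≤-trans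
  (disjoint⇒≤∣transversal∣ {T = ⊤} disjoint λ i → let v , v∈ = nonempty (M∈E i) in v , ∈⊤ , v∈)
  (∣p∣≤n ⊤)

-- Edges are indexed by pairs of an owner `w` and a slot in its matching, so a set occurring in
-- several matchings counts with multiplicity. Odd cycles of indexed edges are still odd cycles of
-- sets in `E`.
augment : ∀ {n q} {E : Subset n → Set} → OddCycleFree E → (∀ {Q} → E Q → Nonempty Q) →
  0 < n → 0 < q → (∀ w → Matching (λ Q → E Q × w ∉ Q) q) → Matching E (suc q)
augment {suc k} {q@(suc _)} {E} acyclic nonempty _ _ N = e ∘ g , e∈E ∘ g , disjoint
  where
  M : Fin (suc k) → Fin q → Subset (suc k)
  M w = proj₁ (N w)

  e : Fin (suc k * q) → Subset (suc k)
  e x = uncurry M (remQuot q x)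

  e∈E : ∀ x → E (e x)
  e∈E x = let w , i = remQuot {suc k} q x in proj₁ (proj₁ (proj₂ (N w)) i)

  owner : Fin (suc k * q) → Fin (suc k)
  owner x = proj₁ (remQuot {suc k} q x)

  owner≢ : ∀ x {v} → v ∈ e x → v ≢ owner x
  owner≢ x v∈x refl = let w , i = remQuot {suc k} q x in proj₂ (proj₁ (proj₂ (N w)) i) v∈x

  slots-equal : ∀ {v} w i w′ i′ → v ∈ M w i → v ∈ M w′ i′ → w ≡ w′ → (w , i) ≡ (w′ , i′)
  slots-equal {v} w i w′ i′ v∈ v∈′ refl with i ≟ i′
  ... | yes refl = refl
  ... | no i≢i′  = ⊥-elim (proj₂ (proj₂ (N w)) i i′ i≢i′ v v∈ v∈′)

  owner-injective : ∀ {v} x y → v ∈ e x → v ∈ e y → owner x ≡ owner y → x ≡ y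
  owner-injective x y v∈x v∈y eq = begin
    x                                      ≡⟨ combine-remQuot {suc k} q x ⟨
    uncurry combine (remQuot {suc k} q x) ≡⟨ cong (uncurry combine) (slots-equal _ _ _ _ v∈x v∈y eq) ⟩
    uncurry combine (remQuot {suc k} q y) ≡⟨ combine-remQuot {suc k} q y ⟩
    y                                      ∎
    where open ≡-Reasoning

  -- Edges at v have distinct owners, none of which is v.
  degree≤k : ∀ v (g : Fin (suc k) → Fin (suc k * q)) → Injective _≡_ _≡_ g → ¬ (∀ i → v ∈ e (g i))
  degree≤k v g g-inj v∈ = ℕ.1+n≰n (injective⇒≤ {f = λ i → punchOut (missed i)} λ {i} {j} eq →
    g-inj (owner-injective (g i) (g j) (v∈ i) (v∈ j) (punchOut-injective (missed i) (missed j) eq)))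
    where
    missed : ∀ i → v ≢ owner (g i)
    missed i = owner≢ (g i) (v∈ i)

  open EdgeColouring e (λ h γ ρ → acyclic h ρ (e ∘ γ) (e∈E ∘ γ)) degree≤k

  initial : Fin (suc k * q) → Fin k
  -- Any starting colouring will do, but `k` is not known to be positive. A vertex of the edge
  -- differs from the owner, so `punchOut` lands in `Fin k`.
  initial x = let v , v∈x = nonempty (e∈E x) in punchOut (owner≢ x v∈x ∘ sym)

  coloured : ∃ (¬_ ∘ Conflict)
  coloured = edgeColouring initial

  c = proj₁ coloured

  large : ∃ λ b → q < ∣ comprehension (λ x → c x ≟ b) ∣
  -- There are `q + k * q` edges; positivity of `q` makes the pigeonhole strict.
  large = largeColourClass c (ℕ.m<n+m (k * q) (s≤s z≤n))

  enumeration = enumerate (comprehension (λ x → c x ≟ proj₁ large)) (proj₂ large)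

  g = proj₁ enumeration

  g-colour : ∀ i → c (g i) ≡ proj₁ large
  g-colour i = ∈-comprehension⁻ (λ x → c x ≟ proj₁ large) (proj₂ (proj₂ enumeration) i)

  disjoint : Disjoint (e ∘ g)
  disjoint i j i≢j v v∈i v∈j = proj₂ coloured
    (v , g i , g j , i≢j ∘ proj₁ (proj₂ enumeration) , v∈i , v∈j ,
     trans (g-colour i) (sym (g-colour j)))

Transversal : ∀ {n} → (Subset n → Set) → Subset n → Set
Transversal E T = ∀ Q → E Q → ∃ λ v → v ∈ T × v ∈ Q

-- Only the hard inequality is recorded; weak duality gives the other.
König : ∀ {n} → (Subset n → Set) → Set
König E = ∃ λ q → Matching E q × ∃ λ T → Transversal E T × ∣ T ∣ ≤ q

könig : ∀ {n} (Es : List (Subset n)) → OddCycleFree (_∈ₗ Es) →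
  (∀ {Q} → Q ∈ₗ Es → Nonempty Q) → König (_∈ₗ Es)
könig {n} Es = go Es (<-wellFounded (length Es))
  where
  avoiding : Fin n → List (Subset n) → List (Subset n)
  avoiding w = filter (λ Q → ¬? (w ∈? Q))

  go : ∀ Es → Acc _<_ (length Es) → OddCycleFree (_∈ₗ Es) →
    (∀ {Q} → Q ∈ₗ Es → Nonempty Q) → König (_∈ₗ Es)
  go [] _ _ _ = 0 , ((λ ()) , (λ ()) , λ ()) , ∅ , (λ _ ()) , ℕ.≤-reflexive (∣⊥∣≡0 n)
  go Es@(Q₀ ∷ _) (acc rec) acyclic nonempty =
    improve n ℕ.≤-refl ((λ _ → Q₀) , (λ _ → Any.here refl) , λ { zero zero 0≢0 → ⊥-elim (0≢0 refl) })
    where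
    ∈-avoiding⁻ : ∀ w {Q} → Q ∈ₗ avoiding w Es → Q ∈ₗ Es × w ∉ Q
    ∈-avoiding⁻ w = ∈-filter⁻ (λ Q → ¬? (w ∈? Q)) {xs = Es}

    Avoiding : ℕ → Fin n → Set
    Avoiding q w = Matching (λ Q → Q ∈ₗ Es × w ∉ Q) q

    recurse : ∀ w → Any (w ∈_) Es → König (_∈ₗ avoiding w Es)
    recurse w covered = go (avoiding w Es)
      (rec (filter-notAll (λ Q → ¬? (w ∈? Q)) Es (Any.map (λ w∈Q w∉Q → w∉Q w∈Q) covered)))
      (λ h ρ Q Q∈ → acyclic h ρ Q (proj₁ ∘ ∈-avoiding⁻ w ∘ Q∈))
      (nonempty ∘ proj₁ ∘ ∈-avoiding⁻ w)

    -- If no edge contains `w`, the given matching already misses `w`. Otherwise solve the problem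
    -- without the edges at `w`: an optimum `q′` of at least `q` yields `q` disjoint edges missing
    -- `w`, and a smaller one leaves room to add `w` to the transversal.
    done⊎avoiding : ∀ {q} → Matching (_∈ₗ Es) q → ∀ w → König (_∈ₗ Es) ⊎ Avoiding q w
    done⊎avoiding {q} N@(M , M∈ , disjoint) w with Any.any? (w ∈?_) Es
    ... | no uncovered = inj₂
          (M , (λ i → M∈ i , λ w∈ → uncovered (Any.map (λ { refl → w∈ }) (M∈ i))) , disjoint)
    ... | yes covered with recurse w covered
    ...   | q′ , (M′ , M′∈ , disjoint′) , T , transversal , ∣T∣≤q′ with q ℕ.≤? q′
    ...     | yes q≤q′ = inj₂ (M′ ∘ shrink , ∈-avoiding⁻ w ∘ M′∈ ∘ shrink ,
                λ i j i≢j → disjoint′ (shrink i) (shrink j) (i≢j ∘ inject≤-injective q≤q′ q≤q′ i j))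
      where
      shrink : Fin q → Fin q′
      shrink i = inject≤ i q≤q′
    ...     | no q≰q′ = inj₁ (q , N , T ∪ ⁅ w ⁆ , transversal′ , (begin
                ∣ T ∪ ⁅ w ⁆ ∣     ≤⟨ ∣p∪q∣≤∣p∣+∣q∣ T ⁅ w ⁆ ⟩
                ∣ T ∣ + ∣ ⁅ w ⁆ ∣ ≡⟨ cong (∣ T ∣ +_) (∣⁅x⁆∣≡1 w) ⟩
                ∣ T ∣ + 1         ≡⟨ ℕ.+-comm ∣ T ∣ 1 ⟩
                suc ∣ T ∣         ≤⟨ s≤s ∣T∣≤q′ ⟩
                suc q′            ≤⟨ ℕ.≰⇒> q≰q′ ⟩
                q                 ∎))
      where
      open ℕ.≤-Reasoning
      transversal′ : Transversal (_∈ₗ Es) (T ∪ ⁅ w ⁆)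
      transversal′ Q Q∈ with w ∈? Q
      ... | yes w∈Q = w , q⊆p∪q T ⁅ w ⁆ (x∈⁅x⁆ w) , w∈Q
      ... | no w∉Q =
            let v , v∈T , v∈Q = transversal Q (∈-filter⁺ (λ Q → ¬? (w ∈? Q)) Q∈ w∉Q)
            in v , p⊆p∪q ⁅ w ⁆ v∈T , v∈Q

    0<n : 0 < n
    0<n = ℕ.≤-<-trans z≤n (toℕ<n (proj₁ (nonempty (Any.here refl))))

    -- If no vertex finishes the proof, `augment` enlarges the matching. The size `suc q` keeps it
    -- nonempty, as `augment` demands, and sizes never exceed `n`.
    improve : ∀ {q} fuel → n ≤ q + fuel → Matching (_∈ₗ Es) (suc q) → König (_∈ₗ Es)
    improve {q} zero n≤ N = ⊥-elim (ℕ.<⇒≱ (matching-size≤n nonempty N)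
      (ℕ.≤-trans n≤ (ℕ.≤-reflexive (ℕ.+-identityʳ q))))
    improve {q} (suc fuel) n≤ N with any⊎all (done⊎avoiding N)
    ... | inj₁ done = done
    ... | inj₂ M    = improve fuel (ℕ.≤-trans n≤ (ℕ.≤-reflexive (ℕ.+-suc q fuel)))
            (augment acyclic nonempty 0<n (s≤s z≤n) M)

-- Two-element sets and packing bounds.

∈-tabulate⁺ : ∀ {n} {f : Fin n → Bool} {x} → f x ≡ true → x ∈ tabulate f
∈-tabulate⁺ {f = f} {x} fx = lookup⇒[]= x _ (trans (lookup∘tabulate f x) fx)

∈-tabulate⁻ : ∀ {n} {f : Fin n → Bool} {x} → x ∈ tabulate f → f x ≡ true
∈-tabulate⁻ {f = f} {x} x∈ = trans (sym (lookup∘tabulate f x)) ([]=⇒lookup x∈)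

pair⇒2≤∣∣ : ∀ {n} {p : Subset n} {x y} → x ∈ p → y ∈ p → x ≢ y → 2 ≤ ∣ p ∣
pair⇒2≤∣∣ {p = p} {x} {y} x∈ y∈ x≢y = injection⇒≤∣∣ {g = g} g-inj g∈
  where
  g : Fin 2 → _
  g zero       = x
  g (suc zero) = y
  g-inj : Injective _≡_ _≡_ g
  g-inj {zero}     {zero}     _  = refl
  g-inj {zero}     {suc zero} eq = ⊥-elim (x≢y eq)
  g-inj {suc zero} {zero}     eq = ⊥-elim (x≢y (sym eq))
  g-inj {suc zero} {suc zero} _  = refl
  g∈ : ∀ i → g i ∈ p
  g∈ zero       = x∈
  g∈ (suc zero) = y∈

∣pair∣≡2 : ∀ {n} {f : Fin n → Bool} {x y} → x ≢ y → f x ≡ true → f y ≡ true →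
  (∀ z → f z ≡ true → z ≡ x ⊎ z ≡ y) → ∣ tabulate f ∣ ≡ 2
∣pair∣≡2 {f = f} {x} {y} x≢y fx fy only = ℕ.≤-antisym (begin
    ∣ tabulate f ∣        ≤⟨ p⊆q⇒∣p∣≤∣q∣ ⊆pair ⟩
    ∣ ⁅ x ⁆ ∪ ⁅ y ⁆ ∣     ≤⟨ ∣p∪q∣≤∣p∣+∣q∣ ⁅ x ⁆ ⁅ y ⁆ ⟩
    ∣ ⁅ x ⁆ ∣ + ∣ ⁅ y ⁆ ∣ ≡⟨ cong₂ _+_ (∣⁅x⁆∣≡1 x) (∣⁅x⁆∣≡1 y) ⟩
    2                     ∎)
  (pair⇒2≤∣∣ (∈-tabulate⁺ fx) (∈-tabulate⁺ fy) x≢y)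
  where
  open ℕ.≤-Reasoning
  ⊆pair : tabulate f ⊆ ⁅ x ⁆ ∪ ⁅ y ⁆
  ⊆pair z∈ with only _ (∈-tabulate⁻ z∈)
  ... | inj₁ refl = p⊆p∪q ⁅ y ⁆ (x∈⁅x⁆ x)
  ... | inj₂ refl = q⊆p∪q ⁅ x ⁆ ⁅ y ⁆ (x∈⁅x⁆ y)

1≤∣∣⇒nonempty : ∀ {n} {p : Subset n} → 1 ≤ ∣ p ∣ → Nonempty p
1≤∣∣⇒nonempty {p = p} le = let g , _ , g∈ = enumerate p le in g zero , g∈ zero

2≤∣∣⇒pair : ∀ {n} {p : Subset n} → 2 ≤ ∣ p ∣ → ∃ λ x → ∃ λ y → x ∈ p × y ∈ p × x ≢ y
2≤∣∣⇒pair {p = p} le = let g , g-inj , g∈ = enumerate p le in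
  g zero , g (suc zero) , g∈ zero , g∈ (suc zero) , 0≢1+n ∘ g-inj

-- Choosing `s` elements in each set embeds the pairs of a set and a choice into `Fin n`.
disjoint⇒*≤ : ∀ {n t s} {Q : Fin t → Subset n} → Disjoint Q → (∀ i → s ≤ ∣ Q i ∣) → t * s ≤ n
disjoint⇒*≤ {n} {t} {s} {Q} disjoint s≤ = injective⇒≤ {f = uncurry pick ∘ remQuot {t} s} injective
  where
  pick : Fin t → Fin s → Fin n
  pick i = proj₁ (enumerate (Q i) (s≤ i))

  pick∈ : ∀ i a → pick i a ∈ Q i
  pick∈ i = proj₂ (proj₂ (enumerate (Q i) (s≤ i)))

  pick-injective : ∀ i a j b → pick i a ≡ pick j b → (i , a) ≡ (j , b)
  pick-injective i a j b eq with i ≟ j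
  ... | yes refl = cong (i ,_) (proj₁ (proj₂ (enumerate (Q i) (s≤ i))) eq)
  ... | no i≢j   = ⊥-elim (disjoint i j i≢j _ (pick∈ i a) (subst (_∈ Q j) (sym eq) (pick∈ j b)))

  injective : Injective _≡_ _≡_ (uncurry pick ∘ remQuot {t} s)
  injective {x} {y} eq = begin
    x                                ≡⟨ combine-remQuot {t} s x ⟨
    uncurry combine (remQuot {t} s x) ≡⟨ cong (uncurry combine) (pick-injective _ _ _ _ eq) ⟩
    uncurry combine (remQuot {t} s y) ≡⟨ combine-remQuot {t} s y ⟩
    y                                ∎
    where open ≡-Reasoning

-- Deciding maximality and extending cliques.

isClique? : ∀ G S → Dec (IsClique G S)
isClique? G S = nonempty? S ×-dec all? λ u → all? λ v →
  (u ∈? S) →-dec ((v ∈? S) →-dec (¬? (u ≟ v) →-dec (adj G u v Bool.≟ true)))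

StrictExtension : ∀ G → Subset (n G) → Subset (n G) → Set
StrictExtension G S T = IsClique G T × S ⊆ T × ¬ T ⊆ S

strictExtension? : ∀ G S → Dec (∃ (StrictExtension G S))
strictExtension? G S = anySubset? λ T → isClique? G T ×-dec (S ⊆? T) ×-dec ¬? (T ⊆? S)

unextendable⇒maximal : ∀ G {S} → ¬ ∃ (StrictExtension G S) → ∀ T → IsClique G T → S ⊆ T → T ⊆ S
unextendable⇒maximal G {S} ¬ext T clique S⊆T =
  decidable-stable (T ⊆? S) λ T⊈S → ¬ext (T , clique , S⊆T , T⊈S)

isMaximalClique? : ∀ G S → Dec (IsMaximalClique G S)
isMaximalClique? G S = isClique? G S ×-dec map′ (unextendable⇒maximal G)
  (λ { maximal (T , clique , S⊆T , T⊈S) → T⊈S (maximal T clique S⊆T) })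
  (¬? (strictExtension? G S))

-- Decidability recovers a usable proof from the irrelevant field.
set-isMax : ∀ G (Q : MaxClique G) → IsMaximalClique G (set Q)
set-isMax G (mkMaxClique S max) = recompute (isMaximalClique? G S) max

-- Each strict extension increases the cardinality, which `n G` bounds.
extendClique : ∀ G {S} → IsClique G S → ∃ λ T → IsMaximalClique G T × S ⊆ T
extendClique G {S} = go (suc (n G)) (ℕ.m≤n+m (suc (n G)) ∣ S ∣)
  where
  go : ∀ fuel {S} → n G < ∣ S ∣ + fuel → IsClique G S → ∃ λ T → IsMaximalClique G T × S ⊆ T
  go zero {S} lt _ = ⊥-elim (ℕ.<⇒≱ lt (ℕ.≤-trans (ℕ.≤-reflexive (ℕ.+-identityʳ ∣ S ∣)) (∣p∣≤n S)))
  go (suc fuel) {S} lt clique with strictExtension? G S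
  ... | no ¬ext = S , (clique , unextendable⇒maximal G ¬ext) , λ x∈ → x∈
  ... | yes (T , T-clique , S⊆T , T⊈S) =
        let R , maximal , T⊆R = go fuel (ℕ.<-≤-trans lt grow) T-clique
        in R , maximal , T⊆R ∘ S⊆T
    where
    strict : ∃ λ x → x ∈ T × x ∉ S
    strict with any? (λ x → (x ∈? T) ×-dec ¬? (x ∈? S))
    ... | yes found = found
    ... | no none   = ⊥-elim (T⊈S λ {x} x∈T → decidable-stable (x ∈? S) λ x∉S → none (x , x∈T , x∉S))

    grow : ∣ S ∣ + suc fuel ≤ ∣ T ∣ + fuel
    grow = ℕ.≤-trans (ℕ.≤-reflexive (ℕ.+-suc ∣ S ∣ fuel))
      (ℕ.+-monoˡ-≤ fuel (p⊂q⇒∣p∣<∣q∣ (S⊆T , strict)))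

true≢false : true ≢ false
true≢false ()

-- Two-regular submatrices in diamond-free graphs.

module _ (G : Graph) (diamondFree : DiamondFree G) where

  adjacent⇒≢ : ∀ {u v} → adj G u v ≡ true → u ≢ v
  adjacent⇒≢ {u} uv refl = true≢false (trans (sym uv) (irrefl G u))

  -- If `w` lies outside `Q` and has a non-neighbour `z` in `Q`, then `x`, `y`, `w`, `z` induce a
  -- diamond with non-edge `w z`. If there is no such `z`, then `Q ∪ ⁅ w ⁆` is a clique and
  -- maximality applies.
  commonNeighbour∈ : ∀ {Q w x y} → IsMaximalClique G Q → x ∈ Q → y ∈ Q → x ≢ y →
    adj G w x ≡ true → adj G w y ≡ true → w ∈ Q
  commonNeighbour∈ {Q} {w} {x} {y} ((_ , complete) , maximal) x∈ y∈ x≢y wx wy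
    with w ∈? Q | any? (λ z → (z ∈? Q) ×-dec (adj G w z Bool.≟ false))
  ... | yes w∈ | _ = w∈
  ... | no w∉ | yes (z , z∈ , wz) = ⊥-elim (diamondFree (f , f-injective , f-diamond))
    where
    xy = complete x y x∈ y∈ x≢y

    z≢ : ∀ {u} → adj G w u ≡ true → u ≢ z
    z≢ wu refl = true≢false (trans (sym wu) wz)

    w≢z : w ≢ z
    w≢z refl = w∉ z∈

    xz = complete x z x∈ z∈ (z≢ wx)
    yz = complete y z y∈ z∈ (z≢ wy)

    flip : ∀ {u v b} → adj G u v ≡ b → adj G v u ≡ b
    flip = trans (Graph.sym G _ _)

    f : Fin 4 → Fin (n G)
    f zero                   = x
    f (suc zero)             = y
    f (suc (suc zero))       = w
    f (suc (suc (suc zero))) = z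

    f-diamond : ∀ i j → adj G (f i) (f j) ≡ diamondAdj i j
    f-diamond zero zero                                     = irrefl G x
    f-diamond zero (suc zero)                               = xy
    f-diamond zero (suc (suc zero))                         = flip wx
    f-diamond zero (suc (suc (suc zero)))                   = xz
    f-diamond (suc zero) zero                               = flip xy
    f-diamond (suc zero) (suc zero)                         = irrefl G y
    f-diamond (suc zero) (suc (suc zero))                   = flip wy
    f-diamond (suc zero) (suc (suc (suc zero)))             = yz
    f-diamond (suc (suc zero)) zero                         = wx
    f-diamond (suc (suc zero)) (suc zero)                   = wy
    f-diamond (suc (suc zero)) (suc (suc zero))             = irrefl G w
    f-diamond (suc (suc zero)) (suc (suc (suc zero)))       = wz
    f-diamond (suc (suc (suc zero))) zero                   = flip xz
    f-diamond (suc (suc (suc zero))) (suc zero)             = flip yz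
    f-diamond (suc (suc (suc zero))) (suc (suc zero))       = flip wz
    f-diamond (suc (suc (suc zero))) (suc (suc (suc zero))) = irrefl G z

    f-injective : Injective _≡_ _≡_ f
    f-injective {zero} {zero} _                                         = refl
    f-injective {zero} {suc zero} eq                                    = ⊥-elim (x≢y eq)
    f-injective {zero} {suc (suc zero)} eq                              = ⊥-elim (adjacent⇒≢ wx (sym eq))
    f-injective {zero} {suc (suc (suc zero))} eq                        = ⊥-elim (z≢ wx eq)
    f-injective {suc zero} {zero} eq                                    = ⊥-elim (x≢y (sym eq))
    f-injective {suc zero} {suc zero} _                                 = refl
    f-injective {suc zero} {suc (suc zero)} eq                          = ⊥-elim (adjacent⇒≢ wy (sym eq))
    f-injective {suc zero} {suc (suc (suc zero))} eq                    = ⊥-elim (z≢ wy eq)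
    f-injective {suc (suc zero)} {zero} eq                              = ⊥-elim (adjacent⇒≢ wx eq)
    f-injective {suc (suc zero)} {suc zero} eq                          = ⊥-elim (adjacent⇒≢ wy eq)
    f-injective {suc (suc zero)} {suc (suc zero)} _                     = refl
    f-injective {suc (suc zero)} {suc (suc (suc zero))} eq              = ⊥-elim (w≢z eq)
    f-injective {suc (suc (suc zero))} {zero} eq                        = ⊥-elim (z≢ wx (sym eq))
    f-injective {suc (suc (suc zero))} {suc zero} eq                    = ⊥-elim (z≢ wy (sym eq))
    f-injective {suc (suc (suc zero))} {suc (suc zero)} eq              = ⊥-elim (w≢z (sym eq))
    f-injective {suc (suc (suc zero))} {suc (suc (suc zero))} _         = refl
  ... | no w∉ | no dominating = maximal (Q ∪ ⁅ w ⁆)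
        ((w , w∈∪) , complete′) (p⊆p∪q ⁅ w ⁆) w∈∪
    where
    w∈∪ : w ∈ Q ∪ ⁅ w ⁆
    w∈∪ = q⊆p∪q Q ⁅ w ⁆ (x∈⁅x⁆ w)

    w-adjacent : ∀ {z} → z ∈ Q → adj G w z ≡ true
    w-adjacent {z} z∈ = Bool.¬-not λ wz → dominating (z , z∈ , wz)

    complete′ : ∀ u v → u ∈ Q ∪ ⁅ w ⁆ → v ∈ Q ∪ ⁅ w ⁆ → u ≢ v → adj G u v ≡ true
    complete′ u v u∈ v∈ u≢v with x∈p∪q⁻ Q ⁅ w ⁆ u∈ | x∈p∪q⁻ Q ⁅ w ⁆ v∈
    ... | inj₁ u∈Q | inj₁ v∈Q = complete u v u∈Q v∈Q u≢v
    ... | inj₁ u∈Q | inj₂ v∈w rewrite x∈⁅y⁆⇒x≡y w v∈w = trans (Graph.sym G u w) (w-adjacent u∈Q)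
    ... | inj₂ u∈w | inj₁ v∈Q rewrite x∈⁅y⁆⇒x≡y w u∈w = w-adjacent v∈Q
    ... | inj₂ u∈w | inj₂ v∈w =
          ⊥-elim (u≢v (trans (x∈⁅y⁆⇒x≡y w u∈w) (sym (x∈⁅y⁆⇒x≡y w v∈w))))

  module TwoRegularSubmatrix {k} (ρ : Fin k → MaxClique G) (γ : Fin k → Fin (n G))
    (γ-injective : Injective _≡_ _≡_ γ)
    (rows : ∀ i → ∣ tabulate (λ j → cliqueMatrix G (ρ i) (γ j)) ∣ ≡ 2)
    (columns : ∀ j → ∣ tabulate (λ i → cliqueMatrix G (ρ i) (γ j)) ∣ ≡ 2) where

    H : Graph
    H = induced G k γ

    M : Fin k → Fin k → Bool
    M i j = cliqueMatrix G (ρ i) (γ j)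

    trace : Fin k → Subset k
    trace i = tabulate (M i)

    ∈-trace⁻ : ∀ {i j} → j ∈ trace i → γ j ∈ set (ρ i)
    ∈-trace⁻ {i} = lookup⇒[]= _ (set (ρ i)) ∘ ∈-tabulate⁻

    ∈-trace⁺ : ∀ {i j} → γ j ∈ set (ρ i) → j ∈ trace i
    ∈-trace⁺ = ∈-tabulate⁺ ∘ []=⇒lookup

    -- A further vertex of a clique of `H` containing the trace is adjacent to both `x` and `y`, so
    -- `commonNeighbour∈` puts it into the row's clique.
    trace-maximal : ∀ i → IsMaximalClique H (trace i)
    trace-maximal i with 2≤∣∣⇒pair (ℕ.≤-reflexive (sym (rows i)))
    ... | x , y , x∈ , y∈ , x≢y = ((x , x∈) , complete) , maximal
      where
      complete : ∀ u v → u ∈ trace i → v ∈ trace i → u ≢ v → adj H u v ≡ true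
      complete u v u∈ v∈ u≢v =
        proj₂ (proj₁ (set-isMax G (ρ i))) _ _ (∈-trace⁻ u∈) (∈-trace⁻ v∈) (u≢v ∘ γ-injective)

      maximal : ∀ T → IsClique H T → trace i ⊆ T → T ⊆ trace i
      maximal T (_ , T-complete) ⊆T {w} w∈T with w ≟ x | w ≟ y
      ... | yes refl | _        = x∈
      ... | _        | yes refl = y∈
      ... | no w≢x   | no w≢y   = ∈-trace⁺ (commonNeighbour∈ (set-isMax G (ρ i))
              (∈-trace⁻ x∈) (∈-trace⁻ y∈) (x≢y ∘ γ-injective)
              (T-complete w x w∈T (⊆T x∈) w≢x) (T-complete w y w∈T (⊆T y∈) w≢y))

    -- Some row contains the column `j`. A clique consisting of `j` alone would lie inside the trace
    -- of that row, which has two vertices.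
    maximalClique-size : ∀ {Q} → IsMaximalClique H Q → 2 ≤ ∣ Q ∣
    maximalClique-size {Q} (((j , j∈Q) , _) , maximal) with 2 ℕ.≤? ∣ Q ∣
    ... | yes 2≤ = 2≤
    ... | no 2≰ =
          let i , i∈ = 1≤∣∣⇒nonempty (ℕ.≤-trans (s≤s z≤n) (ℕ.≤-reflexive (sym (columns j))))
          in subst (_≤ ∣ Q ∣) (rows i) (p⊆q⇒∣p∣≤∣q∣
               (maximal (trace i) (proj₁ (trace-maximal i)) (Q⊆trace i (∈-tabulate⁻ i∈))))
      where
      Q⊆trace : ∀ i → M i j ≡ true → Q ⊆ trace i
      Q⊆trace i Mij {z} z∈ with z ≟ j
      ... | yes refl = ∈-tabulate⁺ Mij
      ... | no z≢j   = ⊥-elim (2≰ (pair⇒2≤∣∣ z∈ j∈Q z≢j))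

    -- Count the incidences between rows and `T`: each row's trace is hit, and each vertex of `T`
    -- lies in two traces.
    k≤∣transversal∣*2 : ∀ {T} → IsCliqueTransversal H T → k ≤ ∣ T ∣ + ∣ T ∣
    k≤∣transversal∣*2 {T} transversal = begin
      k                                     ≡⟨ ℕ.*-identityʳ k ⟨
      k * 1                                 ≡⟨ sum-const k 1 ⟨
      sum {k} (λ _ → 1)                     ≤⟨ sum-mono-≤ hit ⟩
      sum (λ i → sum λ j → entry i j)       ≡⟨ ∑-comm entry ⟩
      sum (λ j → sum λ i → entry i j)       ≤⟨ sum-mono-≤ column ⟩
      sum (λ j → χ j + χ j)                 ≡⟨ ∑-distrib-+ χ χ ⟩
      sum χ + sum χ                         ≡⟨ cong₂ _+_ ∣T∣ ∣T∣ ⟨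
      ∣ T ∣ + ∣ T ∣                         ∎
      where
      open ℕ.≤-Reasoning

      χ : Fin k → ℕ
      χ = indicator ∘ lookup T

      ∣T∣ : ∣ T ∣ ≡ sum χ
      ∣T∣ = trans (cong ∣_∣ (sym (tabulate∘lookup T))) (∣tabulate∣≡sum (lookup T))

      entry : Fin k → Fin k → ℕ
      entry i j = if lookup T j then indicator (M i j) else 0

      hit : ∀ i → 1 ≤ sum (entry i)
      hit i with transversal (trace i) (trace-maximal i)
      ... | j , j∈T , j∈i = ℕ.≤-trans (s≤s z≤n) (sum-mono-< {f = λ _ → 0} (λ _ → z≤n) j
              (subst (0 <_) (sym entry≡1) (s≤s z≤n)))
        where
        entry≡1 : entry i j ≡ 1
        entry≡1 rewrite []=⇒lookup j∈T | ∈-tabulate⁻ {f = M i} j∈i = refl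

      column : ∀ j → sum (λ i → entry i j) ≤ χ j + χ j
      column j with lookup T j
      ... | false = ℕ.≤-reflexive (sum-replicate-zero k)
      ... | true  = ℕ.≤-reflexive (trans (sym (∣tabulate∣≡sum (λ i → M i j))) (columns j))

    independent-size : ∀ {t Q} → IsCliqueIndependent H t Q → t * 2 ≤ k
    independent-size (maximal , disjoint) = disjoint⇒*≤ disjoint (maximalClique-size ∘ maximal)

-- Parity: from clique-perfection to balancedness.

odd≢double : ∀ m t → suc (m * 2) ≢ t * 2
odd≢double zero    (suc zero)    ()
odd≢double zero    (suc (suc t)) ()
odd≢double (suc m) (suc t) eq = odd≢double m t (ℕ.suc-injective (ℕ.suc-injective eq))

-- On the subgraph induced by the columns the common value `t` satisfies `t * 2 ≤ k ≤ t + t`, which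
-- makes `k` even.
cliquePerfect⇒balanced : ∀ G → DiamondFree G → CliquePerfect G → BalancedGraph G
cliquePerfect⇒balanced G diamondFree perfect k (m , refl) ρ γ _ γ-injective (rows , columns)
  with perfect k γ γ-injective
... | t , ((T , transversal , refl) , _) , ((Q , independent) , _) =
      odd≢double m ∣ T ∣ (ℕ.≤-antisym
        (subst (k ≤_) double (k≤∣transversal∣*2 transversal)) (independent-size independent))
  where
  open TwoRegularSubmatrix G diamondFree ρ γ γ-injective rows columns
  double : ∣ T ∣ + ∣ T ∣ ≡ ∣ T ∣ * 2
  double = trans (cong (∣ T ∣ +_) (sym (ℕ.+-identityʳ ∣ T ∣))) (ℕ.*-comm 2 ∣ T ∣)

-- Odd cycles of cliques as submatrices of the clique matrix.

cyclicPred-surjective : ∀ {k} (b : Fin (suc k)) → ∃ λ a → cyclicPred a ≡ b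
cyclicPred-surjective b with view b
... | ‵fromℕ     = zero , refl
... | ‵inject₁ i = suc i , refl

cyclicPred-injective : ∀ {k} {a b : Fin (suc k)} → cyclicPred a ≡ cyclicPred b → a ≡ b
cyclicPred-injective {a = zero}  {zero}  _  = refl
cyclicPred-injective {a = zero}  {suc j} eq = ⊥-elim (fromℕ≢inject₁ eq)
cyclicPred-injective {a = suc i} {zero}  eq = ⊥-elim (fromℕ≢inject₁ (sym eq))
cyclicPred-injective {a = suc i} {suc j} eq = cong suc (inject₁-injective eq)

cyclicPred-≢ : ∀ {k} (a : Fin (2 + k)) → cyclicPred a ≢ a
cyclicPred-≢ zero    ()
cyclicPred-≢ (suc i) eq = ℕ.1+n≢n (sym (trans (sym (toℕ-inject₁ i)) (cong toℕ eq)))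

cyclicPred²-≢ : ∀ {k} (a : Fin (3 + k)) → cyclicPred (cyclicPred a) ≢ a
cyclicPred²-≢ zero ()
cyclicPred²-≢ (suc zero) ()
cyclicPred²-≢ (suc (suc i)) eq = ℕ.<⇒≢ (ℕ.m<n⇒m<1+n (ℕ.n<1+n (toℕ i)))
  (trans (sym (trans (toℕ-inject₁ (inject₁ i)) (toℕ-inject₁ i))) (cong toℕ eq))

-- Distinct indices would be each other's predecessor, which length at least 3 excludes. This
-- separates both the rows and the columns of the submatrix.
cyclicPair-injective : ∀ {k} {a b : Fin (3 + k)} →
  a ≡ b ⊎ a ≡ cyclicPred b → b ≡ a ⊎ b ≡ cyclicPred a → a ≡ b
cyclicPair-injective (inj₁ eq) _         = eq
cyclicPair-injective (inj₂ _)  (inj₁ eq) = sym eq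
cyclicPair-injective {b = b} (inj₂ refl) (inj₂ eq) = ⊥-elim (cyclicPred²-≢ b (sym eq))

-- Extend the image of each `Q b` to a maximal clique `R b` of `G`. The vertices that `f` sends into
-- `R b` form a clique containing `Q b`, hence equal `Q b` by maximality. So incidences are
-- preserved, and an odd cycle becomes a forbidden submatrix.
balanced⇒induced-oddCycleFree : ∀ G → BalancedGraph G → ∀ m (f : Fin m → Fin (n G)) →
  Injective _≡_ _≡_ f → OddCycleFree (IsMaximalClique (induced G m f))
balanced⇒induced-oddCycleFree G balanced m f f-injective h ρ Q Q-maximal cyclic =
  balanced (3 + h * 2) (suc h , refl) row (f ∘ ρ) row-injective column-injective
    (row-size , column-size)
  where
  inImage? : ∀ b v → Dec (∃ λ j → j ∈ Q b × f j ≡ v)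
  inImage? b v = any? λ j → (j ∈? Q b) ×-dec (f j ≟ v)

  image : ∀ b → Subset (n G)
  image b = comprehension (inImage? b)

  image-clique : ∀ b → IsClique G (image b)
  image-clique b with proj₁ (Q-maximal b)
  ... | (j , j∈) , complete = (f j , ∈-comprehension⁺ (inImage? b) (j , j∈ , refl)) , complete′
    where
    complete′ : ∀ u v → u ∈ image b → v ∈ image b → u ≢ v → adj G u v ≡ true
    complete′ u v u∈ v∈ u≢v with ∈-comprehension⁻ (inImage? b) u∈ | ∈-comprehension⁻ (inImage? b) v∈
    ... | i , i∈ , refl | j , j∈ , refl = complete i j i∈ j∈ (u≢v ∘ cong f)

  extension : ∀ b → ∃ λ R → IsMaximalClique G R × image b ⊆ R
  extension b = extendClique G (image-clique b)

  R : Fin (3 + h * 2) → Subset (n G)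
  R b = proj₁ (extension b)

  Q⊆R : ∀ b {j} → j ∈ Q b → f j ∈ R b
  Q⊆R b j∈ = proj₂ (proj₂ (extension b)) (∈-comprehension⁺ (inImage? b) (_ , j∈ , refl))

  R⊆Q : ∀ b {j} → f j ∈ R b → j ∈ Q b
  R⊆Q b fj∈ = proj₂ (Q-maximal b) (comprehension inR?) (nonempty , complete)
    (∈-comprehension⁺ inR? ∘ Q⊆R b) (∈-comprehension⁺ inR? fj∈)
    where
    inR? = λ j → f j ∈? R b
    nonempty : Nonempty (comprehension inR?)
    nonempty = _ , ∈-comprehension⁺ inR? fj∈
    complete : ∀ u v → u ∈ comprehension inR? → v ∈ comprehension inR? → u ≢ v →
      adj G (f u) (f v) ≡ true
    complete u v u∈ v∈ u≢v = proj₂ (proj₁ (proj₁ (proj₂ (extension b)))) _ _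
      (∈-comprehension⁻ inR? u∈) (∈-comprehension⁻ inR? v∈) (u≢v ∘ f-injective)

  row : Fin (3 + h * 2) → MaxClique G
  row b = mkMaxClique (R b) (proj₁ (proj₂ (extension b)))

  incident⁺ : ∀ a b → b ≡ a ⊎ b ≡ cyclicPred a → f (ρ a) ∈ R b
  incident⁺ a b = Q⊆R b ∘ proj₂ (cyclic a b)

  incident⁻ : ∀ a b → f (ρ a) ∈ R b → b ≡ a ⊎ b ≡ cyclicPred a
  incident⁻ a b = proj₁ (cyclic a b) ∘ R⊆Q b

  entry⁺ : ∀ a b → b ≡ a ⊎ b ≡ cyclicPred a → cliqueMatrix G (row b) (f (ρ a)) ≡ true
  entry⁺ a b = []=⇒lookup ∘ incident⁺ a b

  entry⁻ : ∀ a b → cliqueMatrix G (row b) (f (ρ a)) ≡ true → b ≡ a ⊎ b ≡ cyclicPred a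
  entry⁻ a b = incident⁻ a b ∘ lookup⇒[]= _ (R b)

  row-injective : Injective _≡_ _≡_ row
  row-injective {b} {b′} eq = cyclicPair-injective
    (incident⁻ b′ b (subst (f (ρ b′) ∈_) (sym R≡) (incident⁺ b′ b′ (inj₁ refl))))
    (incident⁻ b b′ (subst (f (ρ b) ∈_) R≡ (incident⁺ b b (inj₁ refl))))
    where
    R≡ : R b ≡ R b′
    R≡ = cong set eq

  column-injective : Injective _≡_ _≡_ (f ∘ ρ)
  column-injective {a} {a′} eq = cyclicPair-injective
    (incident⁻ a′ a (subst (_∈ R a) eq (incident⁺ a a (inj₁ refl))))
    (incident⁻ a a′ (subst (_∈ R a′) (sym eq) (incident⁺ a′ a′ (inj₁ refl))))

  row-size : ∀ b → ∣ tabulate (λ a → cliqueMatrix G (row b) (f (ρ a))) ∣ ≡ 2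
  row-size b with cyclicPred-surjective b
  -- The match turns `b` into `cyclicPred s`: row `b` meets the columns `b` and its successor `s`.
  ... | s , refl = ∣pair∣≡2 (cyclicPred-≢ s) (entry⁺ b b (inj₁ refl)) (entry⁺ s b (inj₂ refl))
        λ a → Sum.map sym (sym ∘ cyclicPred-injective) ∘ entry⁻ a b

  column-size : ∀ a → ∣ tabulate (λ b → cliqueMatrix G (row b) (f (ρ a))) ∣ ≡ 2
  column-size a = ∣pair∣≡2 (cyclicPred-≢ a ∘ sym) (entry⁺ a a (inj₁ refl))
    (entry⁺ a (cyclicPred a) (inj₂ refl)) (entry⁻ a)

-- Equality of transversal and independence numbers.

allSubsets : ∀ n → List (Subset n)
allSubsets zero    = [] ∷ []
allSubsets (suc n) = map (true ∷_) (allSubsets n) ++ map (false ∷_) (allSubsets n)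

∈-allSubsets : ∀ {n} (p : Subset n) → p ∈ₗ allSubsets n
∈-allSubsets []          = Any.here refl
∈-allSubsets (true ∷ p)  = ∈-++⁺ˡ (∈-map⁺ _ (∈-allSubsets p))
∈-allSubsets (false ∷ p) = ∈-++⁺ʳ _ (∈-map⁺ _ (∈-allSubsets p))

-- Filtering all subsets presents the maximal cliques as a list for `könig`. Weak duality then makes
-- its matching and its transversal both optimal.
oddCycleFree⇒τ≡α : ∀ G → OddCycleFree (IsMaximalClique G) → ∃ λ t → τc≡ G t × αc≡ G t
oddCycleFree⇒τ≡α G acyclic =
  let q , (M , M∈ , disjoint) , T , hits , ∣T∣≤q = könig maximalCliques
        (λ h ρ Q Q∈ → acyclic h ρ Q (maximal ∘ Q∈)) (proj₁ ∘ proj₁ ∘ maximal)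

      transversal : IsCliqueTransversal G T
      transversal S S-maximal =
        hits S (∈-filter⁺ (isMaximalClique? G) (∈-allSubsets S) S-maximal)

      weakDuality : ∀ {k Q T} → IsCliqueIndependent G k Q → IsCliqueTransversal G T → k ≤ ∣ T ∣
      weakDuality (Q-maximal , Q-disjoint) T-transversal =
        disjoint⇒≤∣transversal∣ Q-disjoint λ i → T-transversal _ (Q-maximal i)

      independent : IsCliqueIndependent G q M
      independent = maximal ∘ M∈ , disjoint
  in q , ( (T , transversal , ℕ.≤-antisym ∣T∣≤q (weakDuality independent transversal))
         , λ _ → weakDuality independent)
       , ( (M , independent)
         , λ _ _ Q-independent → ℕ.≤-trans (weakDuality Q-independent transversal) ∣T∣≤q)
  where
  maximalCliques = filter (isMaximalClique? G) (allSubsets (n G))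

  maximal : ∀ {Q} → Q ∈ₗ maximalCliques → IsMaximalClique G Q
  maximal = proj₂ ∘ ∈-filter⁻ (isMaximalClique? G) {xs = allSubsets (n G)}

balanced⇒cliquePerfect : ∀ G → BalancedGraph G → CliquePerfect G
balanced⇒cliquePerfect G balanced m f f-injective =
  oddCycleFree⇒τ≡α (induced G m f) (balanced⇒induced-oddCycleFree G balanced m f f-injective)

theorem10 : (G : Graph) → DiamondFree G →
    (CliquePerfect G → BalancedGraph G) × (BalancedGraph G → CliquePerfect G)
theorem10 G diamondFree = cliquePerfect⇒balanced G diamondFree , balanced⇒cliquePerfect G
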